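{- Let $h\ge 3$ and let $m$ be a positive integer with $\omega=\omega(m)\ge 2$, and let $\varpi=\varpi(m)$. Then there are $\mathrm{CC}_h[m]$-circuits of size $2^{O\left(n^{1/((\omega-1)(h-2)+\varpi)}\log n\right)}$ computing the $n$-ary conjunction $\mathrm{AND}_n$.
   Context: For $A\subseteq\{0,\dots,m-1\}$, the gate $\mathrm{MOD}_m^A$ (unbounded fan-in) outputs $1$ iff the sum of its boolean inputs modulo $m$ lies in $A$. Multiple wires between gates (including input gates) are allowed. A $\mathrm{CC}_h[m]$-circuit is a circuit of depth $h$ built from gates $\mathrm{MOD}_m^A$ (with arbitrary, possibly different, $A$). The size of a circuit is its number of gates. $\omega(m)$ is the number of distinct prime divisors of $m$, and $\varpi(m)$ is the number of prime divisors $p$ of $m$ with $p\ge\omega(m)$. -}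

module Defs where

open import Data.Nat using (ℕ; _≡ᵇ_; zero; suc; _+_; _*_; _∸_; _^_; _≤_; _⊔_; NonZero)
open import Data.Nat.DivMod using (_mod_)
open import Data.Nat.Primality using (prime?)
open import Data.Nat.Divisibility using (_∣?_)
open import Data.Nat.Properties using (_≤?_)
open import Data.Bool using (Bool; true; false; _∧_; if_then_else_)
open import Data.Fin using (Fin; zero; suc)
open import Data.List using (List; length; filter; upTo)
open import Relation.Nullary.Decidable using (_×-dec_)
open import Relation.Binary.PropositionalEquality using (_≡_)

sumF : ∀ {k} → (Fin k → ℕ) → ℕ
sumF {zero} f = 0
sumF {suc k} f = f zero + sumF (λ i → f (suc i))

maxF : ∀ {k} → (Fin k → ℕ) → ℕ
maxF {zero} f = 0
maxF {suc k} f = f zero ⊔ maxF (λ i → f (suc i))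

andF : ∀ {k} → (Fin k → Bool) → Bool
andF {zero} f = true
andF {suc k} f = f zero ∧ andF (λ i → f (suc i))

ω : ℕ → ℕ
ω m = length (filter (λ p → prime? p ×-dec (p ∣? m)) (upTo (suc m)))

ϖ : ℕ → ℕ
ϖ m = length (filter (λ p → prime? p ×-dec ((p ∣? m) ×-dec (ω m ≤? p))) (upTo (suc m)))

-- A MOD_m^A gate in a circuit with n inputs, placed after k earlier gates.
-- acc encodes A ⊆ {0,…,m-1}; inW / gW give wire multiplicities from
-- the inputs and from the earlier gates (multiple wires allowed).
record Gate (m n k : ℕ) : Set where
  field
    acc : Fin m → Bool
    inW : Fin n → ℕ
    gW  : Fin k → ℕ

-- A circuit with n inputs and s gates (in topological order) built
-- from MOD_m gates.
data Circ (m n : ℕ) : ℕ → Set where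
  []  : Circ m n 0
  _▷_ : ∀ {k} → Circ m n k → Gate m n k → Circ m n (suc k)

b2n : Bool → ℕ
b2n true = 1
b2n false = 0

eval : ∀ {m n k} .{{_ : NonZero m}} → Circ m n k → (Fin n → Bool) → Fin k → Bool
eval [] x ()
eval {m} (c ▷ g) x zero =
  Gate.acc g ((sumF (λ i → Gate.inW g i * b2n (x i))
             + sumF (λ j → Gate.gW g j * b2n (eval c x j))) mod m)
eval (c ▷ g) x (suc j) = eval c x j

gateDepth : ∀ {m n k} → Circ m n k → Fin k → ℕ
gateDepth [] ()
gateDepth (c ▷ g) zero =
  suc (maxF (λ j → if Gate.gW g j ≡ᵇ 0 then 0 else gateDepth c j))
gateDepth (c ▷ g) (suc j) = gateDepth c j

depth : ∀ {m n k} → Circ m n k → ℕ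
depth c = maxF (gateDepth c)

Computes : ∀ {m n s} .{{_ : NonZero m}} → Circ m n s → Fin s → ((Fin n → Bool) → Bool) → Set
Computes c o f = ∀ x → eval c x o ≡ f x

AND : (n : ℕ) → (Fin n → Bool) → Bool
AND n x = andF x

{-# OPTIONS --safe #-}

-- Work with sums of gates modulo a prime p ∣ m, which the next layer can absorb for free.
-- By induction on h, every conjunction of t^(1+(h-1)(ω-1)) inputs is, modulo each p, a sum of
-- 2^O(t log t) gates of depth h.  For h = 1 this is Fourier inversion over ℤ/q for another prime
-- q ∣ m.  For the step, cut the inputs into t^ω blocks and let s be the number of blocks that are
-- not all true.  If p^e is the least power of p above t, the truncated sum ∑_{i<p^e} (-1)^i (s C i),
-- which is ±((s-1) C (p^e-1)) for s > 0, is 1 for s = 0 and vanishes modulo p unless p^e ∣ s.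
-- It is a polynomial of degree O(t) in the block conjunctions, and its monomials are conjunctions
-- handled by the induction hypothesis.  A single MOD_m gate checks all these sums at once, and
-- they are all 1 only for s = 0, because the product of the powers p^e exceeds t^ω ≥ s.
-- This gives the exponent (ω-1)(h-2)+ω, at least as large as the required one since ϖ ≤ ω.
module Submission where

open import Defs
open import Data.Nat using (ℕ; zero; suc; _+_; _*_; _∸_; _^_; _≤_; _<_; _≡ᵇ_; ⌊_/2⌋; ⌈_/2⌉; z≤n; s≤s; NonZero; nonTrivial⇒n>1; >-nonZero; >-nonZero⁻¹)
open import Data.Nat.Properties
open import Data.Nat.DivMod using (_%_; _/_; _mod_; m≡m%n+[m/n]*n; m%n<n; m<n⇒m%n≡m; [m+n]%n≡m%n; [m+kn]%n≡m%n; m∣n⇒o%n%m≡o%m)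
open import Data.Nat.Divisibility
open import Data.Nat.Coprimality using (Coprime; coprime-Bézout; coprime-divisor)
import Data.Nat.Coprimality as Coprimality
open import Data.Nat.GCD using (module Bézout)
open import Data.Nat.Combinatorics using (_C_; nC1≡n; nCk+nC[k+1]≡[n+1]C[k+1])
open import Data.Nat.Induction using (<-rec)
open import Data.Nat.ListAction using (product)
open import Data.Nat.Logarithm using (⌈log₂_⌉; ⌈log₂⌉-mono-≤; ⌈log₂⌈n/2⌉⌉≡⌈log₂n⌉∸1)
open import Data.Nat.Primality using (Prime; prime?; ¬prime[1]; prime⇒irreducible; prime⇒nonZero; prime⇒nonTrivial; productOfPrimes≢0)
open import Data.Nat.Tactic.RingSolver using (solve-∀)
open import Data.Bool using (Bool; true; false; _∧_; if_then_else_)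
open import Data.Bool.Properties using (∧-assoc)
open import Data.Bool.ListAction using (all)
open import Data.List using (List; []; _∷_; _++_; length; map; concat; take; drop; filter; upTo; tabulate; allFin)
open import Data.List.Properties using (length-++; length-take; length-drop; take++drop≡id; length-tabulate)
open import Data.List.Relation.Unary.All as All using (All; []; _∷_)
open import Data.List.Relation.Unary.All.Properties using (all-filter)
open import Data.List.Relation.Unary.AllPairs using ([]; _∷_)
open import Data.List.Relation.Unary.Unique.Propositional using (Unique)
open import Data.List.Relation.Unary.Unique.Propositional.Properties using (upTo⁺; filter⁺)
open import Data.Fin using (Fin; zero; suc; toℕ)
open import Data.Fin.Properties using (toℕ-fromℕ<)
open import Data.Product using (Σ; ∃; _×_; _,_; proj₁; proj₂)
open import Data.Sum using (_⊎_; inj₁; inj₂)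
open import Function using (id)
open import Function.Bundles using (mk⇔)
open import Relation.Nullary using (¬_; yes; no; contradiction; does)
open import Relation.Nullary.Decidable using (does-⇔; dec-true; dec-false; _×-dec_)
open import Relation.Unary using (Pred; Decidable; _⊆_)
open import Relation.Binary.PropositionalEquality

-- Congruences

infix 4 _≈_[mod_]

-- Both sides may be shifted, so no subtraction on naturals occurs; `p` may be 0, where the relation
-- is equality.
record _≈_[mod_] (a b p : ℕ) : Set where
  constructor shift
  field
    left right : ℕ
    shifted    : a + left * p ≡ b + right * p

private variable
  a b c d p q : ℕ

≈-reflexive : a ≡ b → a ≈ b [mod p ]
≈-reflexive refl = shift 0 0 refl

≈-refl : a ≈ a [mod p ]
≈-refl = ≈-reflexive refl

≈-sym : a ≈ b [mod p ] → b ≈ a [mod p ]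
≈-sym (shift k l e) = shift l k (sym e)

≈-trans : a ≈ b [mod p ] → b ≈ c [mod p ] → a ≈ c [mod p ]
≈-trans {a} {b} {p} {c} (shift k l e) (shift k′ l′ e′) = shift (k + k′) (l′ + l) (begin
  a + (k + k′) * p     ≡⟨ assoc a k k′ p ⟩
  a + k * p + k′ * p   ≡⟨ cong (_+ k′ * p) e ⟩
  b + l * p + k′ * p   ≡⟨ swap b l k′ p ⟩
  b + k′ * p + l * p   ≡⟨ cong (_+ l * p) e′ ⟩
  c + l′ * p + l * p   ≡⟨ assoc c l′ l p ⟨
  c + (l′ + l) * p     ∎)
  where
  open ≡-Reasoning
  assoc : ∀ a k l p → a + (k + l) * p ≡ a + k * p + l * p
  assoc = solve-∀
  swap : ∀ a k l p → a + k * p + l * p ≡ a + l * p + k * p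
  swap = solve-∀

≈-+ : a ≈ b [mod p ] → c ≈ d [mod p ] → a + c ≈ b + d [mod p ]
≈-+ {a} {b} {p} {c} {d} (shift k l e) (shift k′ l′ e′) =
  shift (k + k′) (l + l′) (trans (regroup a c k k′ p) (trans (cong₂ _+_ e e′) (sym (regroup b d l l′ p))))
  where
  regroup : ∀ a c k k′ p → a + c + (k + k′) * p ≡ (a + k * p) + (c + k′ * p)
  regroup = solve-∀

≈-*ˡ : ∀ c → a ≈ b [mod p ] → c * a ≈ c * b [mod p ]
≈-*ˡ {a} {b} {p} c (shift k l e) =
  shift (c * k) (c * l) (trans (factor c a k p) (trans (cong (c *_) e) (sym (factor c b l p))))
  where
  factor : ∀ c a k p → c * a + c * k * p ≡ c * (a + k * p)
  factor = solve-∀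

≈-* : a ≈ b [mod p ] → c ≈ d [mod p ] → a * c ≈ b * d [mod p ]
≈-* {a} {b} {p} {c} {d} e e′ =
  ≈-trans (≈-*ˡ a e′) (≈-trans (≈-reflexive (*-comm a d)) (≈-trans (≈-*ˡ d e) (≈-reflexive (*-comm d b))))

≈-+-cancelʳ : ∀ c → a + c ≈ b + c [mod p ] → a ≈ b [mod p ]
≈-+-cancelʳ {a} {b} {p} c (shift k l e) =
  shift k l (+-cancelˡ-≡ c _ _ (trans (move c a (k * p)) (trans e (sym (move c b (l * p))))))
  where
  move : ∀ c a k → c + (a + k) ≡ a + c + k
  move = solve-∀

≈0⇒∣ : a ≈ 0 [mod p ] → p ∣ a
≈0⇒∣ {a} {p} (shift k l e) =
  ∣m+n∣m⇒∣n (subst (p ∣_) (trans (sym e) (+-comm a (k * p))) (n∣m*n l)) (n∣m*n k)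

∣⇒≈0 : p ∣ a → a ≈ 0 [mod p ]
∣⇒≈0 {p} {a} (divides k e) = shift 0 k (trans (+-identityʳ a) e)

≈-∣ : q ∣ p → a ≈ b [mod p ] → a ≈ b [mod q ]
≈-∣ {q} {p} {a} {b} (divides r refl) (shift k l e) =
  shift (k * r) (l * r) (trans (cong (a +_) (*-assoc k r q)) (trans e (cong (b +_) (sym (*-assoc l r q)))))

≈⇒% : .{{_ : NonZero p}} → a ≈ b [mod p ] → a % p ≡ b % p
≈⇒% {p} {a} {b} (shift k l e) =
  trans (sym ([m+kn]%n≡m%n a k p)) (trans (cong (_% p) e) ([m+kn]%n≡m%n b l p))

%⇒≈ : .{{_ : NonZero p}} → a % p ≡ b % p → a ≈ b [mod p ]
%⇒≈ {p} {a} {b} e = shift (b / p) (a / p) (begin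
  a + b / p * p                  ≡⟨ cong (_+ b / p * p) (m≡m%n+[m/n]*n a p) ⟩
  a % p + a / p * p + b / p * p  ≡⟨ cong (λ r → r + a / p * p + b / p * p) e ⟩
  b % p + a / p * p + b / p * p  ≡⟨ swap (b % p) (a / p * p) (b / p * p) ⟩
  b % p + b / p * p + a / p * p  ≡⟨ cong (_+ a / p * p) (m≡m%n+[m/n]*n b p) ⟨
  b + a / p * p                  ∎)
  where
  open ≡-Reasoning
  swap : ∀ r s t → r + s + t ≡ r + t + s
  swap = solve-∀

coprime⇒inverse : Coprime a p → ∃ λ u → u * a ≈ 1 [mod p ]
coprime⇒inverse {a} {p} cop with coprime-Bézout cop
... | Bézout.+- x y e = x , shift 0 y (trans (+-identityʳ (x * a)) (sym e))
-- Here `1 + x * a ≡ y * p`, so `x * a` is -1 modulo `p`, its square is 1, and `x * a * x` inverts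
-- `a`.
... | Bézout.-+ x y e = x * a * x , shift y (x * a * y) (begin
  x * a * x * a + y * p          ≡⟨ cong (x * a * x * a +_) e ⟨
  x * a * x * a + (1 + x * a)    ≡⟨ square x a ⟩
  1 + x * a * (1 + x * a)        ≡⟨ cong (λ r → 1 + x * a * r) e ⟩
  1 + x * a * (y * p)            ≡⟨ cong suc (*-assoc (x * a) y p) ⟨
  1 + x * a * y * p              ∎)
  where
  open ≡-Reasoning
  square : ∀ x a → x * a * x * a + (1 + x * a) ≡ 1 + x * a * (1 + x * a)
  square = solve-∀

≈-*-cancelˡ : Coprime c p → c * a ≈ c * b [mod p ] → a ≈ b [mod p ]
≈-*-cancelˡ {c} {p} {a} {b} cop e with u , uc≈1 ← coprime⇒inverse cop =
  ≈-trans (≈-sym (undo a)) (≈-trans (≈-*ˡ u e) (undo b))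
  where
  undo : ∀ x → u * (c * x) ≈ x [mod p ]
  undo x = ≈-trans (≈-reflexive (sym (*-assoc u c x)))
    (≈-trans (≈-* uc≈1 ≈-refl) (≈-reflexive (*-identityˡ x)))

coprime-* : Coprime a c → Coprime b c → Coprime (a * b) c
coprime-* {a} {c} {b} a⊥c b⊥c {d} (d∣ab , d∣c) = b⊥c (coprime-divisor d⊥a d∣ab , d∣c)
  where
  d⊥a : Coprime d a
  d⊥a (e∣d , e∣a) = a⊥c (e∣a , ∣-trans e∣d d∣c)

coprime-^ : ∀ k → Coprime a c → Coprime (a ^ k) c
coprime-^ {c = c} zero    a⊥c = Coprimality.1-coprimeTo c
coprime-^         (suc k) a⊥c = coprime-* a⊥c (coprime-^ k a⊥c)

coprime-∣ : Coprime a b → a ∣ c → b ∣ c → a * b ∣ c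
coprime-∣ {a} {b} a⊥b a∣c (divides k refl) =
  subst (_∣ k * b) (*-comm b a) (subst (b * a ∣_) (*-comm b k) (*-monoʳ-∣ b
    (coprime-divisor a⊥b (subst (a ∣_) (*-comm k b) a∣c))))

prime∧∤⇒coprime : Prime p → ¬ p ∣ a → Coprime p a
prime∧∤⇒coprime pr p∤a (d∣p , d∣a) with prime⇒irreducible pr d∣p
... | inj₁ d≡1  = d≡1
... | inj₂ refl = contradiction d∣a p∤a

distinct-primes⇒coprime : Prime p → Prime q → p ≢ q → Coprime p q
distinct-primes⇒coprime {p} pr qr p≢q = prime∧∤⇒coprime pr p∤q
  where
  p∤q : ¬ p ∣ _
  p∤q p∣q with prime⇒irreducible qr p∣q
  ... | inj₁ refl = ¬prime[1] pr
  ... | inj₂ p≡q  = p≢q p≡q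

-- Binomial coefficients modulo a prime

absorption : ∀ n k → suc k * (suc n C suc k) ≡ suc n * (n C k)
absorption n       zero    = trans (*-identityˡ (suc n C 1)) (trans (nC1≡n (suc n)) (sym (*-identityʳ (suc n))))
absorption zero    (suc k) = *-zeroʳ k
absorption (suc n) (suc k) = begin
  (2 + k) * (suc (suc n) C suc (suc k))
    ≡⟨ cong ((2 + k) *_) (nCk+nC[k+1]≡[n+1]C[k+1] (suc n) (suc k)) ⟨
  (2 + k) * (x + (suc n C suc (suc k)))
    ≡⟨ split k x (suc n C suc (suc k)) ⟩
  x + (suc k * x + (2 + k) * (suc n C suc (suc k)))
    ≡⟨ cong (x +_) (cong₂ _+_ (absorption n k) (absorption n (suc k))) ⟩
  x + (suc n * (n C k) + suc n * (n C suc k))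
    ≡⟨ cong (x +_) (*-distribˡ-+ (suc n) (n C k) (n C suc k)) ⟨
  x + suc n * (n C k + n C suc k)
    ≡⟨ cong (λ y → x + suc n * y) (nCk+nC[k+1]≡[n+1]C[k+1] n k) ⟩
  (2 + n) * x ∎
  where
  open ≡-Reasoning
  x : ℕ
  x = suc n C suc k
  split : ∀ k x y → (2 + k) * (x + y) ≡ x + (suc k * x + (2 + k) * y)
  split = solve-∀

-- By `absorption`, `p ^ e` divides `(s C k) * suc s`. If `p` did not divide the binomial, `p ^ e`
-- would be coprime to it and would divide `suc s`.
p^e∤1+s⇒p∣sC[p^e∸1] : ∀ e {s k} → Prime p → p ^ e ≡ suc k → ¬ p ^ e ∣ suc s → p ∣ s C k
p^e∤1+s⇒p∣sC[p^e∸1] {p} e {s} {k} pr p^e≡1+k p^e∤1+s with p ∣? (s C k)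
... | yes p∣C = p∣C
... | no  p∤C = contradiction (coprime-divisor (coprime-^ e (prime∧∤⇒coprime pr p∤C)) p^e∣) p^e∤1+s
  where
  p^e∣ : p ^ e ∣ (s C k) * suc s
  p^e∣ = subst₂ _∣_ (sym p^e≡1+k) (trans (absorption s k) (*-comm (suc s) (s C k)))
    (m∣m*n (suc s C suc k))

-- The truncated alternating sum ∑_{i≤N} (-1)ⁱ (s C i) in closed form, with p ∸ 1 for -1.
altSum : (p N s : ℕ) → ℕ
altSum p N zero    = 1
altSum p N (suc s) = (p ∸ 1) ^ N * (s C N)

altSum-0 : ∀ s → altSum p 0 s ≡ 1
altSum-0 zero    = refl
altSum-0 (suc s) = refl

1+[p∸1]≡p : .{{_ : NonZero p}} → 1 + (p ∸ 1) ≡ p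
1+[p∸1]≡p {suc p} = refl

-- Pascal's rule, read as S(N+1, s+1) = S(N+1, s) - S(N, s). At `s = 0` both terms on the left are
-- ±1 and cancel, since 1 + (p - 1) = p.
altSum-step : .{{_ : NonZero p}} → ∀ N s →
  altSum p (suc N) s + (p ∸ 1) * altSum p N s ≈ altSum p (suc N) (suc s) [mod p ]
altSum-step {p} N zero = ≈-trans (≈-reflexive (trans (cong (1 +_) (*-identityʳ (p ∸ 1))) 1+[p∸1]≡p))
  (≈-trans (∣⇒≈0 ∣-refl) (≈-reflexive (sym (*-zeroʳ ((p ∸ 1) ^ suc N)))))
altSum-step {p} N (suc s) = ≈-reflexive (begin
  r * r ^ N * (s C suc N) + r * (r ^ N * (s C N))  ≡⟨ factor r (r ^ N) (s C N) (s C suc N) ⟩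
  r * r ^ N * (s C N + s C suc N)                  ≡⟨ cong (r * r ^ N *_) (nCk+nC[k+1]≡[n+1]C[k+1] s N) ⟩
  r * r ^ N * (suc s C suc N)                      ∎)
  where
  open ≡-Reasoning
  r : ℕ
  r = p ∸ 1
  factor : ∀ r x y z → r * x * z + r * (x * y) ≡ r * x * (y + z)
  factor = solve-∀

altSum≈0 : ∀ e s → Prime p → ¬ p ^ e ∣ s → altSum p (p ^ e ∸ 1) s ≈ 0 [mod p ]
altSum≈0 {p} e zero    pr p^e∤s = contradiction ((p ^ e) ∣0) p^e∤s
altSum≈0 {p} e (suc s) pr p^e∤s = ∣⇒≈0 (∣n⇒∣m*n ((p ∸ 1) ^ (p ^ e ∸ 1))
  (p^e∤1+s⇒p∣sC[p^e∸1] e pr (sym (1+[p∸1]≡p {{m^n≢0 p e {{prime⇒nonZero pr}}}})) p^e∤s))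

-- Powers and logarithms

-- For `p ≥ 2` this is the least e with `t < p ^ e`: it grows exactly when the argument reaches the
-- current power.
exponent : (p t : ℕ) → ℕ
exponent p zero    = 0
exponent p (suc t) with p ^ exponent p t ≤? suc t
... | yes _ = suc (exponent p t)
... | no  _ = exponent p t

t<p^exponent : 2 ≤ p → ∀ t → t < p ^ exponent p t
t<p^exponent 2≤p zero = s≤s z≤n
t<p^exponent {p} 2≤p (suc t) with p ^ exponent p t ≤? suc t
... | no  ≰t = ≰⇒> ≰t
... | yes _  = begin-strict
  suc t                        ≤⟨ t<p^exponent 2≤p t ⟩
  p ^ exponent p t             <⟨ ^-monoʳ-< p 2≤p (n<1+n (exponent p t)) ⟩
  p ^ suc (exponent p t)       ∎
  where open ≤-Reasoning

-- The power either stays or, having been at most `suc t`, is multiplied by `p`. This linear bound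
-- keeps the degree of the truncated sum in O(t).
p^exponent≤1+p*t : ∀ p t → p ^ exponent p t ≤ suc (p * t)
p^exponent≤1+p*t p zero = s≤s z≤n
p^exponent≤1+p*t p (suc t) with p ^ exponent p t ≤? suc t
... | no  _  = ≤-trans (p^exponent≤1+p*t p t) (s≤s (*-monoʳ-≤ p (n≤1+n t)))
... | yes ≤t = m≤n⇒m≤1+n (*-monoʳ-≤ p ≤t)

n<2^n : ∀ n → n < 2 ^ n
n<2^n zero    = s≤s z≤n
n<2^n (suc n) = begin-strict
  suc n          ≤⟨ n<2^n n ⟩
  2 ^ n          <⟨ ^-monoʳ-< 2 (s≤s (s≤s z≤n)) (n<1+n n) ⟩
  2 ^ suc n      ∎
  where open ≤-Reasoning

n≤2^⌈log₂n⌉ : ∀ n → n ≤ 2 ^ ⌈log₂ n ⌉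
n≤2^⌈log₂n⌉ = <-rec (λ n → n ≤ 2 ^ ⌈log₂ n ⌉) halve
  where
  halve : ∀ n → (∀ {k} → k < n → k ≤ 2 ^ ⌈log₂ k ⌉) → n ≤ 2 ^ ⌈log₂ n ⌉
  halve zero          ih = z≤n
  halve (suc zero)    ih = s≤s z≤n
  halve (suc (suc n)) ih = begin
    2 + n                                    ≡⟨ ⌊n/2⌋+⌈n/2⌉≡n (2 + n) ⟨
    ⌊ 2 + n /2⌋ + ⌈ 2 + n /2⌉                ≤⟨ +-monoˡ-≤ ⌈ 2 + n /2⌉ (⌊n/2⌋≤⌈n/2⌉ (2 + n)) ⟩
    ⌈ 2 + n /2⌉ + ⌈ 2 + n /2⌉                ≡⟨ cong (⌈ 2 + n /2⌉ +_) (+-identityʳ ⌈ 2 + n /2⌉) ⟨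
    2 * ⌈ 2 + n /2⌉                          ≤⟨ *-monoʳ-≤ 2 (ih (⌈n/2⌉<n n)) ⟩
    2 ^ suc ⌈log₂ ⌈ 2 + n /2⌉ ⌉              ≡⟨ cong (λ k → 2 ^ suc k) (⌈log₂⌈n/2⌉⌉≡⌈log₂n⌉∸1 (2 + n)) ⟩
    2 ^ suc (⌈log₂ 2 + n ⌉ ∸ 1)              ≡⟨⟩
    2 ^ ⌈log₂ 2 + n ⌉                        ∎
    where open ≤-Reasoning

-- Finite sums and maxima

sumF-cong : ∀ {k} {f g : Fin k → ℕ} → (∀ i → f i ≡ g i) → sumF f ≡ sumF g
sumF-cong {zero}  e = refl
sumF-cong {suc k} e = cong₂ _+_ (e zero) (sumF-cong (λ i → e (suc i)))

sumF-0 : ∀ k → sumF {k} (λ _ → 0) ≡ 0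
sumF-0 zero    = refl
sumF-0 (suc k) = sumF-0 k

sumF-+ : ∀ {k} (f g : Fin k → ℕ) → sumF (λ i → f i + g i) ≡ sumF f + sumF g
sumF-+ {zero}  f g = refl
sumF-+ {suc k} f g = trans (cong (f zero + g zero +_) (sumF-+ (λ i → f (suc i)) (λ i → g (suc i))))
  (interchange (f zero) (g zero) _ _)
  where
  interchange : ∀ a b c d → a + b + (c + d) ≡ a + c + (b + d)
  interchange = solve-∀

sumF-* : ∀ {k} a (f : Fin k → ℕ) → sumF (λ i → a * f i) ≡ a * sumF f
sumF-* {zero}  a f = sym (*-zeroʳ a)
sumF-* {suc k} a f = trans (cong (a * f zero +_) (sumF-* a (λ i → f (suc i))))
  (sym (*-distribˡ-+ a (f zero) (sumF (λ i → f (suc i)))))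

single : ∀ {k} → Fin k → ℕ → Fin k → ℕ
single zero    a zero    = a
single zero    a (suc j) = 0
single (suc i) a zero    = 0
single (suc i) a (suc j) = single i a j

sumF-single : ∀ {k} (i : Fin k) a (f : Fin k → ℕ) → sumF (λ j → single i a j * f j) ≡ a * f i
sumF-single {suc k} zero    a f = trans (cong (a * f zero +_) (sumF-0 k)) (+-identityʳ (a * f zero))
sumF-single {suc k} (suc i) a f = sumF-single i a (λ j → f (suc j))

maxF-lub : ∀ {k h} {f : Fin k → ℕ} → (∀ i → f i ≤ h) → maxF f ≤ h
maxF-lub {zero}  b = z≤n
maxF-lub {suc k} b = ⊔-lub (b zero) (maxF-lub (λ i → b (suc i)))

-- Weighted sums of gates

module Synthesis (m n : ℕ) .{{_ : NonZero m}} where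

  Input : Set
  Input = Fin n → Bool

  form : (Fin n → ℕ) → Input → ℕ
  form w x = sumF (λ i → w i * b2n (x i))

  gateSum : ∀ {k} → Circ m n k → (Fin k → ℕ) → Input → ℕ
  gateSum c w x = sumF (λ j → w j * b2n (eval c x j))

  data _⊑_ {k} (c : Circ m n k) : ∀ {l} → Circ m n l → Set where
    stop : c ⊑ c
    step : ∀ {l} {c′ : Circ m n l} {g : Gate m n l} → c ⊑ c′ → c ⊑ (c′ ▷ g)

  ⊑-trans : ∀ {k l o} {c : Circ m n k} {d : Circ m n l} {e : Circ m n o} → c ⊑ d → d ⊑ e → c ⊑ e
  ⊑-trans c⊑d stop       = c⊑d
  ⊑-trans c⊑d (step d⊑e) = step (⊑-trans c⊑d d⊑e)

  ⊑-depth : ∀ {k l} {c : Circ m n k} {d : Circ m n l} → c ⊑ d → depth c ≤ depth d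
  ⊑-depth stop = ≤-refl
  ⊑-depth (step {c′ = c′} c⊑c′) = ≤-trans (⊑-depth c⊑c′) (m≤n⊔m _ (depth c′))

  -- Only gates of nonzero weight are bounded: the shared circuit may hold deeper gates, and wires
  -- of multiplicity 0 do not count in `gateDepth`.
  Shallow : ∀ {k} → ℕ → Circ m n k → (Fin k → ℕ) → Set
  Shallow h c w = ∀ j → w j ≡ 0 ⊎ gateDepth c j ≤ h

  extend : ∀ {k l} {c : Circ m n k} {d : Circ m n l} → c ⊑ d → (Fin k → ℕ) → Fin l → ℕ
  extend stop       w         = w
  extend (step c⊑d) w zero    = 0
  extend (step c⊑d) w (suc j) = extend c⊑d w j

  extend-shallow : ∀ {k l h} {c : Circ m n k} {d : Circ m n l} (c⊑d : c ⊑ d) {w : Fin k → ℕ} →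
    Shallow h c w → Shallow h d (extend c⊑d w)
  extend-shallow stop       sh j       = sh j
  extend-shallow (step c⊑d) sh zero    = inj₁ refl
  extend-shallow (step c⊑d) sh (suc j) = extend-shallow c⊑d sh j

  extend-gateSum : ∀ {k l} {c : Circ m n k} {d : Circ m n l} (c⊑d : c ⊑ d) (w : Fin k → ℕ) x →
    gateSum d (extend c⊑d w) x ≡ gateSum c w x
  extend-gateSum stop       w x = refl
  extend-gateSum (step c⊑d) w x = extend-gateSum c⊑d w x

  -- Equivalent to `depth d ≤ h ⊔ depth c`; phrased through upper bounds `H`, it composes by
  -- function composition.
  DepthPreserving : ∀ {k l} → ℕ → Circ m n k → Circ m n l → Set
  DepthPreserving h c d = ∀ H → h ≤ H → depth c ≤ H → depth d ≤ H

  record ExtendsToSum {k} (c : Circ m n k) (h : ℕ) (f : Input → ℕ) (B : ℕ) : Set where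
    field
      {size}   : ℕ
      circuit  : Circ m n size
      extends  : c ⊑ circuit
      size≤    : size ≤ k + B
      depth≤   : DepthPreserving h c circuit
      weight   : Fin size → ℕ
      shallow  : Shallow h circuit weight
      computes : ∀ x → gateSum circuit weight x ≡ f x

  -- Quantifying over all circuits c lets sums be built one after another inside a
  -- single growing circuit; B counts the added gates only.
  GateSum : ℕ → (Input → ℕ) → ℕ → Set
  GateSum h f B = ∀ {k} (c : Circ m n k) → ExtendsToSum c h f B

  record ExtendsToGate {k} (c : Circ m n k) (h : ℕ) (f : Input → Bool) (B : ℕ) : Set where
    field
      {size}   : ℕ
      circuit  : Circ m n (suc size)
      extends  : c ⊑ circuit
      size≤    : suc size ≤ k + B
      depth≤   : DepthPreserving h c circuit
      shallow  : gateDepth circuit zero ≤ h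
      computes : Computes circuit zero f

  GateFor : ℕ → (Input → Bool) → ℕ → Set
  GateFor h f B = ∀ {k} (c : Circ m n k) → ExtendsToGate c h f B

  private variable
    h B B′ : ℕ
    f f′ : Input → ℕ

  weaken : B ≤ B′ → GateSum h f B → GateSum h f B′
  weaken B≤B′ F {k} c = record { ExtendsToSum (F c) ; size≤ = ≤-trans (ExtendsToSum.size≤ (F c)) (+-monoʳ-≤ k B≤B′) }

  weakenGate : ∀ {F} → B ≤ B′ → GateFor h F B → GateFor h F B′
  weakenGate B≤B′ G {k} c = record { ExtendsToGate (G c) ; size≤ = ≤-trans (ExtendsToGate.size≤ (G c)) (+-monoʳ-≤ k B≤B′) }

  gateSum-0 : GateSum h (λ _ → 0) 0
  gateSum-0 {k = k} c = record
    { circuit  = c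
    ; extends  = stop
    ; size≤    = m≤m+n k 0
    ; depth≤   = λ _ _ d → d
    ; weight   = λ _ → 0
    ; shallow  = λ _ → inj₁ refl
    ; computes = λ _ → sumF-0 k
    }

  gateSum-* : ∀ a → GateSum h f B → GateSum h (λ x → a * f x) B
  gateSum-* {h = h} a F c = record
    { ExtendsToSum (F c)
    ; weight   = λ j → a * weight j
    ; shallow  = sh
    ; computes = λ x → trans (sumF-cong (λ j → *-assoc a (weight j) (b2n (eval circuit x j))))
        (trans (sumF-* a (λ j → weight j * b2n (eval circuit x j))) (cong (a *_) (computes x)))
    }
    where
    open ExtendsToSum (F c)
    sh : Shallow h circuit (λ j → a * weight j)
    sh j with shallow j
    ... | inj₁ e = inj₁ (trans (cong (a *_) e) (*-zeroʳ a))
    ... | inj₂ d = inj₂ d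

  gateSum-+ : GateSum h f B → GateSum h f′ B′ → GateSum h (λ x → f x + f′ x) (B + B′)
  gateSum-+ {h = h} {B = B} {B′ = B′} F F′ {k} c = record
    { circuit  = S.circuit
    ; extends  = ⊑-trans R.extends S.extends
    ; size≤    = ≤-trans S.size≤ (≤-trans (+-monoˡ-≤ B′ R.size≤) (≤-reflexive (+-assoc k B B′)))
    ; depth≤   = λ H h≤H d → S.depth≤ H h≤H (R.depth≤ H h≤H d)
    ; weight   = λ j → w j + S.weight j
    ; shallow  = sh
    ; computes = λ x → trans (sumF-cong (λ j → *-distribʳ-+ (b2n (eval S.circuit x j)) (w j) (S.weight j)))
        (trans (sumF-+ (λ j → w j * b2n (eval S.circuit x j)) (λ j → S.weight j * b2n (eval S.circuit x j)))
          (cong₂ _+_ (trans (extend-gateSum S.extends R.weight x) (R.computes x)) (S.computes x)))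
    }
    where
    module R = ExtendsToSum (F c)
    module S = ExtendsToSum (F′ R.circuit)
    w : Fin S.size → ℕ
    w = extend S.extends R.weight
    sh : Shallow h S.circuit (λ j → w j + S.weight j)
    sh j with extend-shallow S.extends R.shallow j | S.shallow j
    ... | inj₁ e | inj₁ e′ = inj₁ (cong₂ _+_ e e′)
    ... | inj₂ d | _       = inj₂ d
    ... | _      | inj₂ d  = inj₂ d

  gateSum-gate : ∀ {F : Input → Bool} → GateFor h F B → GateSum h (λ x → b2n (F x)) B
  gateSum-gate G c = record
    { circuit  = circuit
    ; extends  = extends
    ; size≤    = size≤
    ; depth≤   = depth≤
    ; weight   = single zero 1
    ; shallow  = λ { zero → inj₂ shallow ; (suc j) → inj₁ refl }
    ; computes = λ x → trans (sumF-single zero 1 (λ j → b2n (eval circuit x j)))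
        (trans (*-identityˡ _) (cong b2n (computes x)))
    }
    where
    open ExtendsToGate (G c)

  wire-depth : ∀ w {d} → w ≡ 0 ⊎ d ≤ h → (if w ≡ᵇ 0 then 0 else d) ≤ h
  wire-depth zero    _        = z≤n
  wire-depth (suc w) (inj₂ d) = d

  -- The weights become wire multiplicities into the new gate, so forming the sum costs neither
  -- gates nor depth.
  gate : (acc : Fin m → Bool) → GateSum h f B → GateFor (suc h) (λ x → acc (f x mod m)) (suc B)
  gate {h = h} {B = B} acc F {k} c = record
    { circuit  = circuit ▷ g
    ; extends  = step extends
    ; size≤    = ≤-trans (s≤s size≤) (≤-reflexive (sym (+-suc k B)))
    ; depth≤   = λ H h<H d → ⊔-lub (≤-trans g-depth h<H) (depth≤ H (≤-trans (n≤1+n h) h<H) d)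
    ; shallow  = g-depth
    ; computes = λ x → cong (λ s → acc (s mod m)) (cong₂ _+_ (sumF-0 n) (computes x))
    }
    where
    open ExtendsToSum (F c)
    g : Gate m n size
    g = record { acc = acc ; inW = λ _ → 0 ; gW = weight }
    g-depth : gateDepth (circuit ▷ g) zero ≤ suc h
    g-depth = s≤s (maxF-lub (λ j → wire-depth (weight j) (shallow j)))

  inputGate : (acc : Fin m → Bool) (w : Fin n → ℕ) → GateFor 1 (λ x → acc (form w x mod m)) 1
  inputGate acc w {k} c = record
    { circuit  = c ▷ g
    ; extends  = step stop
    ; size≤    = ≤-reflexive (+-comm 1 k)
    ; depth≤   = λ H 1≤H d → ⊔-lub (≤-trans g-depth 1≤H) d
    ; shallow  = g-depth
    ; computes = λ x → cong (λ s → acc (s mod m)) (trans (cong (form w x +_) (sumF-0 k)) (+-identityʳ (form w x)))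
    }
    where
    g : Gate m n k
    g = record { acc = acc ; inW = w ; gW = λ _ → 0 }
    g-depth : gateDepth (c ▷ g) zero ≤ 1
    g-depth = s≤s (maxF-lub {k} {f = λ j → 0} (λ j → z≤n))

  -- For `q ∣ m` this accepting set lets a MOD_m gate test a residue modulo `q`.
  residueIs : (q a : ℕ) .{{_ : NonZero q}} → Fin m → Bool
  residueIs q a i = does (toℕ i % q ≟ a % q)

  toℕ-mod-% : ∀ {q} .{{_ : NonZero q}} → q ∣ m → ∀ s → toℕ (s mod m) % q ≡ s % q
  toℕ-mod-% {q} q∣m s = trans (cong (_% q) (toℕ-fromℕ< (m%n<n s m))) (m∣n⇒o%n%m≡o%m q m s q∣m)

  residueIs-mod : ∀ {q} .{{_ : NonZero q}} → q ∣ m → ∀ a s → residueIs q a (s mod m) ≡ does (s % q ≟ a % q)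
  residueIs-mod {q} q∣m a s = cong (λ r → does (r ≟ a % q)) (toℕ-mod-% q∣m s)

-- Telescoping sums of residue indicators

sumBelow : ℕ → (ℕ → ℕ) → ℕ
sumBelow zero    f = 0
sumBelow (suc k) f = sumBelow k f + f k

sumBelow-cong : ∀ k {f g : ℕ → ℕ} → (∀ c → f c ≡ g c) → sumBelow k f ≡ sumBelow k g
sumBelow-cong zero    e = refl
sumBelow-cong (suc k) e = cong₂ _+_ (sumBelow-cong k e) (e k)

sumBelow-const : ∀ k y → sumBelow k (λ _ → y) ≡ k * y
sumBelow-const zero    y = refl
sumBelow-const (suc k) y = trans (cong (_+ y) (sumBelow-const k y)) (+-comm (k * y) y)

sumBelow-* : ∀ k y f → sumBelow k (λ c → y * f c) ≡ y * sumBelow k f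
sumBelow-* zero    y f = sym (*-zeroʳ y)
sumBelow-* (suc k) y f = trans (cong (_+ y * f k) (sumBelow-* k y f)) (sym (*-distribˡ-+ y (sumBelow k f) (f k)))

module _ (q : ℕ) .{{_ : NonZero q}} where

  indicator : (l a : ℕ) → ℕ
  indicator l a = b2n (does (l % q ≟ a % q))

  indicator-shift : ∀ l a c → indicator (l + c) (a + c) ≡ indicator l a
  indicator-shift l a c = cong b2n (does-⇔ (mk⇔ to from) ((l + c) % q ≟ (a + c) % q) (l % q ≟ a % q))
    where
    to : (l + c) % q ≡ (a + c) % q → l % q ≡ a % q
    to e = ≈⇒% (≈-+-cancelʳ c (%⇒≈ e))
    from : l % q ≡ a % q → (l + c) % q ≡ (a + c) % q
    from e = ≈⇒% (≈-+ (%⇒≈ e) ≈-refl)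

  indicator-period : ∀ l a → indicator l (a + q) ≡ indicator l a
  indicator-period l a = cong (λ r → b2n (does (l % q ≟ r))) ([m+n]%n≡m%n a q)

  module _ (p : ℕ) .{{_ : NonZero p}} where

    -- [l ≡ a] - [l ≡ a + 1] modulo p, where the residues are taken modulo q.
    difference : (l a : ℕ) → ℕ
    difference l a = indicator l a + (p ∸ 1) * indicator l (suc a)

    difference-shift : ∀ l a c → difference (l + c) (a + c) ≡ difference l a
    difference-shift l a c = cong₂ _+_ (indicator-shift l a c) (cong ((p ∸ 1) *_) (indicator-shift l (suc a) c))

    -- Each intermediate indicator is collected `1 + (p ∸ 1) = p` times and so vanishes modulo `p`.
    telescope : ∀ l a k → sumBelow k (λ c → difference l (a + c)) + indicator l (a + k) ≈ indicator l a [mod p ]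
    telescope l a zero    = ≈-reflexive (cong (indicator l) (+-identityʳ a))
    telescope l a (suc k) = ≈-trans (≈-reflexive collect)
      (≈-trans (≈-+ (telescope l a k) (∣⇒≈0 (m∣m*n {p} (indicator l (suc (a + k))))))
        (≈-reflexive (+-identityʳ (indicator l a))))
      where
      open ≡-Reasoning
      S χ χ′ : ℕ
      S  = sumBelow k (λ c → difference l (a + c))
      χ  = indicator l (a + k)
      χ′ = indicator l (suc (a + k))
      regroup : ∀ s x r y → s + (x + r * y) + y ≡ s + x + (1 + r) * y
      regroup = solve-∀
      collect : S + (χ + (p ∸ 1) * χ′) + indicator l (a + suc k) ≡ S + χ + p * χ′
      collect = begin
        S + (χ + (p ∸ 1) * χ′) + indicator l (a + suc k) ≡⟨ cong (λ b → S + (χ + (p ∸ 1) * χ′) + indicator l b) (+-suc a k) ⟩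
        S + (χ + (p ∸ 1) * χ′) + χ′                      ≡⟨ regroup S χ (p ∸ 1) χ′ ⟩
        S + χ + (1 + (p ∸ 1)) * χ′                       ≡⟨ cong (λ r → S + χ + r * χ′) 1+[p∸1]≡p ⟩
        S + χ + p * χ′                                   ∎

    -- After `q` steps the telescope ends at the indicator where it began.
    difference-period : ∀ l a → sumBelow q (λ c → difference l (a + c)) ≈ 0 [mod p ]
    difference-period l a = ≈-+-cancelʳ (indicator l a) (≈-trans
      (≈-reflexive (cong (sumBelow q (λ c → difference l (a + c)) +_) (sym (indicator-period l a))))
      (telescope l a q))

    difference-00 : 2 ≤ q → difference 0 0 ≡ 1
    difference-00 1<q = trans (cong₂ (λ i j → b2n i + (p ∸ 1) * b2n j)
        (dec-true (0 % q ≟ 0 % q) refl) (dec-false (0 % q ≟ 1 % q) 0%q≢1%q))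
      (cong suc (*-zeroʳ (p ∸ 1)))
      where
      0%q≢1%q : 0 % q ≢ 1 % q
      0%q≢1%q e with () ← trans (sym (m<n⇒m%n≡m (≤-trans (s≤s z≤n) 1<q))) (trans e (m<n⇒m%n≡m 1<q))

-- Sums of gates modulo a prime

module ModularSynthesis (m n : ℕ) .{{_ : NonZero m}} where

  open Synthesis m n public

  -- The weights are naturals, but working up to congruence modulo `p` provides negatives, as
  -- `p ∸ 1`, and inverses of numbers coprime to `p`.
  GateSumMod : (p h : ℕ) → (Input → ℕ) → ℕ → Set
  GateSumMod p h F B = ∃ λ f → GateSum h f B × (∀ x → f x ≈ F x [mod p ])

  private variable
    h B B′ : ℕ
    F F′ : Input → ℕ

  respects : (∀ x → F x ≈ F′ x [mod p ]) → GateSumMod p h F B → GateSumMod p h F′ B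
  respects F≈F′ (f , R , f≈F) = f , R , λ x → ≈-trans (f≈F x) (F≈F′ x)

  weakenMod : B ≤ B′ → GateSumMod p h F B → GateSumMod p h F B′
  weakenMod B≤B′ (f , R , f≈F) = f , weaken B≤B′ R , f≈F

  gateSumMod-gate : ∀ {G : Input → Bool} → GateFor h G B → GateSumMod p h (λ x → b2n (G x)) B
  gateSumMod-gate {G = G} R = (λ x → b2n (G x)) , gateSum-gate R , λ x → ≈-refl

  gateSumMod-* : ∀ a → GateSumMod p h F B → GateSumMod p h (λ x → a * F x) B
  gateSumMod-* a (f , R , f≈F) = _ , gateSum-* a R , λ x → ≈-*ˡ a (f≈F x)

  gateSumMod-+ : GateSumMod p h F B → GateSumMod p h F′ B′ → GateSumMod p h (λ x → F x + F′ x) (B + B′)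
  gateSumMod-+ (f , R , f≈F) (f′ , R′ , f′≈F′) = _ , gateSum-+ R R′ , λ x → ≈-+ (f≈F x) (f′≈F′ x)

  gateSumMod-sumBelow : ∀ k {G : ℕ → Input → ℕ} → (∀ c → GateSumMod p h (G c) B) →
    GateSumMod p h (λ x → sumBelow k (λ c → G c x)) (k * B)
  gateSumMod-sumBelow zero    R = _ , gateSum-0 , λ x → ≈-refl
  gateSumMod-sumBelow {B = B} (suc k) R =
    weakenMod (≤-reflexive (+-comm (k * B) B)) (gateSumMod-+ (gateSumMod-sumBelow k R) (R k))

  form-single : ∀ w v c x → form (λ i → w i + single v c i) x ≡ form w x + c * b2n (x v)
  form-single w v c x = trans (sumF-cong (λ i → *-distribʳ-+ (b2n (x i)) (w i) (single v c i)))
    (trans (sumF-+ (λ i → w i * b2n (x i)) (λ i → single v c i * b2n (x i)))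
      (cong (form w x +_) (sumF-single v c (λ i → b2n (x i)))))

  -- A conjunction of d inputs is q⁻ᵈ times the sum over c ∈ (ℤ/q)ᵈ of
  -- [c·x = c·1] - [c·x = c·1 + 1]: a false input makes the sum over its coefficient telescope to 0.
  module Bottom (p q : ℕ) .{{_ : NonZero p}} .{{_ : NonZero q}} (q∣m : q ∣ m) (q⊥p : Coprime q p) where

    u : ℕ
    u = proj₁ (coprime⇒inverse q⊥p)

    cancel-u : ∀ y → u * (q * y) ≈ y [mod p ]
    cancel-u y = ≈-trans (≈-reflexive (sym (*-assoc u q y)))
      (≈-trans (≈-* (proj₂ (coprime⇒inverse q⊥p)) ≈-refl) (≈-reflexive (*-identityˡ y)))

    indicator-gate : ∀ w a → GateSum 1 (λ x → b2n (residueIs q a (form w x mod m))) 1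
    indicator-gate w a = gateSum-gate (inputGate (residueIs q a) w)

    -- Inputs are peeled off one at a time, which needs an arbitrary form `w` and offset `a`: the
    -- coefficient `c` of `v` is added to both, and `u` divides the sum over `c` by `q`. The factor
    -- 2 counts the two indicators left at the end.
    all*difference : ∀ vs w a → GateSumMod p 1 (λ x → b2n (all x vs) * difference q p (form w x) a) (2 * q ^ length vs)
    all*difference [] w a =
      _ , gateSum-+ (indicator-gate w a) (gateSum-* (p ∸ 1) (indicator-gate w (suc a))) ,
      λ x → ≈-reflexive (trans
        (cong₂ (λ i j → b2n i + (p ∸ 1) * b2n j) (residueIs-mod q∣m a (form w x)) (residueIs-mod q∣m (suc a) (form w x)))
        (sym (*-identityˡ (difference q p (form w x) a))))
    all*difference (v ∷ vs) w a =
      respects value (weakenMod (≤-reflexive (swap q (q ^ length vs)))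
        (gateSumMod-* u (gateSumMod-sumBelow q (λ c → all*difference vs (λ i → w i + single v c i) (a + c)))))
      where
      swap : ∀ q r → q * (2 * r) ≡ 2 * (q * r)
      swap = solve-∀
      value : ∀ x → u * sumBelow q (λ c → b2n (all x vs) * difference q p (form (λ i → w i + single v c i) x) (a + c))
                  ≈ b2n (all x (v ∷ vs)) * difference q p (form w x) a [mod p ]
      value x = ≈-trans (≈-reflexive (cong (u *_) (sumBelow-cong q (λ c →
          cong (λ l → A * difference q p l (a + c)) (form-single w v c x))))) (by-cases (x v))
        where
        A L : ℕ
        A = b2n (all x vs)
        L = form w x
        by-cases : ∀ b → u * sumBelow q (λ c → A * difference q p (L + c * b2n b) (a + c))
                       ≈ b2n (b ∧ all x vs) * difference q p L a [mod p ]
        -- For a true input `c` moves form and offset together, so all `q` summands agree; for a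
        -- false one only the offset moves, through a full period.
        by-cases true = ≈-trans (≈-reflexive (cong (u *_) (trans
          (sumBelow-cong q (λ c → cong (A *_) (trans
            (cong (λ d → difference q p (L + d) (a + c)) (*-identityʳ c)) (difference-shift q p L a c))))
          (sumBelow-const q (A * difference q p L a)))))
          (cancel-u (A * difference q p L a))
        by-cases false = ≈-trans (≈-reflexive (cong (u *_) (trans
          (sumBelow-cong q (λ c → cong (λ d → A * difference q p d (a + c)) (trans (cong (L +_) (*-zeroʳ c)) (+-identityʳ L))))
          (sumBelow-* q A (λ c → difference q p L (a + c))))))
          (≈-trans (≈-*ˡ u (≈-*ˡ A (difference-period q p L a)))
            (≈-reflexive (trans (cong (u *_) (*-zeroʳ A)) (*-zeroʳ u))))

    conjunction : 2 ≤ q → ∀ vs → GateSumMod p 1 (λ x → b2n (all x vs)) (2 * q ^ length vs)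
    -- With zero form and offset the extra factor is [0 ≡ 0] - [0 ≡ 1] = 1, where `2 ≤ q` keeps 0
    -- and 1 apart.
    conjunction 2≤q vs = respects (λ x → ≈-reflexive (trans
        (cong (b2n (all x vs) *_) (trans (cong (λ l → difference q p l 0) (sumF-0 n)) (difference-00 q p 2≤q)))
        (*-identityʳ (b2n (all x vs)))))
      (all*difference vs (λ _ → 0) 0)

-- Products of distinct primes

≈-scale : ∀ c → a ≈ b [mod p ] → c * a ≈ c * b [mod c * p ]
≈-scale {a} {b} {p} c (shift k l e) =
  shift k l (trans (factor c a k p) (trans (cong (c *_) e) (sym (factor c b l p))))
  where
  factor : ∀ c a k p → c * a + k * (c * p) ≡ c * (a + k * p)
  factor = solve-∀

2≤prime : Prime p → 2 ≤ p
2≤prime {p} pr = nonTrivial⇒n>1 p {{prime⇒nonTrivial pr}}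

coprime-product : ∀ {ns} → All (Coprime a) ns → Coprime a (product ns)
coprime-product {a} []           = Coprimality.sym (Coprimality.1-coprimeTo a)
coprime-product     (a⊥n ∷ a⊥ns) =
  Coprimality.sym (coprime-* (Coprimality.sym a⊥n) (Coprimality.sym (coprime-product a⊥ns)))

coprime-primes : ∀ {ps} → Prime p → All (p ≢_) ps → All Prime ps → All (Coprime p) ps
coprime-primes pr []           []         = []
coprime-primes pr (p≢q ∷ p≢qs) (qr ∷ qrs) = distinct-primes⇒coprime pr qr p≢q ∷ coprime-primes pr p≢qs qrs

coprime-powers : ∀ (e : ℕ → ℕ) {ns} → All (Coprime a) ns → All (Coprime a) (map (λ n → n ^ e n) ns)
coprime-powers e []                   = []
coprime-powers e {n ∷ _} (a⊥n ∷ a⊥ns) =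
  Coprimality.sym (coprime-^ (e n) (Coprimality.sym a⊥n)) ∷ coprime-powers e a⊥ns

product-∣ : ∀ {ps} → Unique ps → All Prime ps → All (_∣ a) ps → product ps ∣ a
product-∣ []             []         []             = 1∣ _
product-∣ (p≢ps ∷ uniq) (pr ∷ prs) (p∣a ∷ ps∣a) =
  coprime-∣ (coprime-product (coprime-primes pr p≢ps prs)) p∣a (product-∣ uniq prs ps∣a)

-- Cutting a conjunction into blocks

chunks : ∀ {A : Set} a b (vs : List A) → length vs ≤ a * b →
  ∃ λ ys → concat ys ≡ vs × length ys ≤ a × All (λ y → length y ≤ b) ys
chunks zero    b []  z≤n = [] , refl , z≤n , []
chunks (suc a) b vs len with ys , concat≡ , len-ys , small ← chunks a b (drop b vs)
    (subst (_≤ a * b) (sym (length-drop b vs)) (m≤n+o⇒m∸n≤o (length vs) b len)) =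
  take b vs ∷ ys ,
  trans (cong (take b vs ++_) concat≡) (take++drop≡id b vs) ,
  s≤s len-ys ,
  subst (_≤ b) (sym (length-take b vs)) (m⊓n≤m b (length vs)) ∷ small

all-++ : ∀ {A : Set} (x : A → Bool) us vs → all x (us ++ vs) ≡ all x us ∧ all x vs
all-++ x []       vs = refl
all-++ x (u ∷ us) vs = trans (cong (x u ∧_) (all-++ x us vs)) (sym (∧-assoc (x u) (all x us) (all x vs)))

failing : ∀ {A : Set} → List (List A) → (A → Bool) → ℕ
failing []       x = 0
failing (y ∷ ys) x = if all x y then failing ys x else suc (failing ys x)

failing≤length : ∀ {A : Set} (ys : List (List A)) x → failing ys x ≤ length ys
failing≤length []       x = z≤n
failing≤length (y ∷ ys) x with all x y
... | true  = m≤n⇒m≤1+n (failing≤length ys x)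
... | false = s≤s (failing≤length ys x)

failing≡0⇒all : ∀ {A : Set} (ys : List (List A)) x → failing ys x ≡ 0 → all x (concat ys) ≡ true
failing≡0⇒all []       x e = refl
failing≡0⇒all (y ∷ ys) x e rewrite all-++ x y (concat ys) with all x y
... | true  = failing≡0⇒all ys x e

all⇒failing≡0 : ∀ {A : Set} (ys : List (List A)) x → all x (concat ys) ≡ true → failing ys x ≡ 0
all⇒failing≡0 []       x e = refl
all⇒failing≡0 (y ∷ ys) x e rewrite all-++ x y (concat ys) with all x y
... | true  = all⇒failing≡0 ys x e

-- One more layer of gates

module Layer (m n : ℕ) .{{_ : NonZero m}} where

  open ModularSynthesis m n public

  Conjunctions : (p h cap B : ℕ) → Set
  Conjunctions p h cap B = ∀ vs → length vs ≤ cap → GateSumMod p h (λ x → b2n (all x vs)) B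

  module _ {p h cap B : ℕ} .{{_ : NonZero p}} (conj : Conjunctions p h cap B) where

    -- With z = 1 - [all y], the sum over ys is S (y ∷ ys) (N + 1) = S ys (N + 1) - z S ys N;
    -- expanding z leaves only conjunctions of at most N blocks.
    altSum-blocks : ∀ {b} N ys pre → All (λ y → length y ≤ b) ys → length pre + N * b ≤ cap →
      GateSumMod p h (λ x → b2n (all x pre) * altSum p N (failing ys x)) (B * (1 + 2 * length ys) ^ N)
    altSum-blocks zero ys pre small fits =
      respects (λ x → ≈-reflexive (sym (trans (cong (b2n (all x pre) *_) (altSum-0 (failing ys x))) (*-identityʳ _))))
        (weakenMod (≤-reflexive (sym (*-identityʳ B))) (conj pre (m+n≤o⇒m≤o (length pre) fits)))
    altSum-blocks (suc N) [] pre small fits =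
      respects (λ x → ≈-reflexive (sym (*-identityʳ _)))
        (weakenMod (≤-reflexive (sym (trans (cong (B *_) (^-zeroˡ (suc N))) (*-identityʳ B))))
          (conj pre (m+n≤o⇒m≤o (length pre) fits)))
    altSum-blocks {b} (suc N) (y ∷ ys) pre (y-small ∷ small) fits =
      -- The term -z S ys N is split as -S ys N + [all y] S ys N; in the last one `y` joins the
      -- monomial collected in `pre`.
      respects value (weakenMod size (gateSumMod-+ (altSum-blocks (suc N) ys pre small fits)
        (gateSumMod-+ (gateSumMod-* (p ∸ 1) (altSum-blocks N ys pre small fits₁))
          (altSum-blocks N ys (y ++ pre) small fits₂))))
      where
      open ≤-Reasoning
      fits₁ : length pre + N * b ≤ cap
      fits₁ = ≤-trans (+-monoʳ-≤ (length pre) (m≤n+m (N * b) b)) fits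
      swap : ∀ u v w → u + v + w ≡ v + (u + w)
      swap = solve-∀
      fits₂ : length (y ++ pre) + N * b ≤ cap
      fits₂ = begin
        length (y ++ pre) + N * b        ≡⟨ cong (_+ N * b) (length-++ y) ⟩
        length y + length pre + N * b    ≤⟨ +-monoˡ-≤ (N * b) (+-monoˡ-≤ (length pre) y-small) ⟩
        b + length pre + N * b           ≡⟨ swap b (length pre) (N * b) ⟩
        length pre + (b + N * b)         ≤⟨ fits ⟩
        cap                              ∎
      l : ℕ
      l = length ys
      collect : ∀ B l X → B * ((1 + 2 * l) * X) + (B * X + B * X) ≡ B * ((1 + 2 * suc l) * X)
      collect = solve-∀
      -- One block more costs T(l+1, N+1) = T(l, N+1) + 2 T(l, N), and (1 + 2l) X + 2X = (1 +
      -- 2(l+1)) X for X = (1 + 2l)^N.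
      size : B * (1 + 2 * l) ^ suc N + (B * (1 + 2 * l) ^ N + B * (1 + 2 * l) ^ N) ≤ B * (1 + 2 * suc l) ^ suc N
      size = begin
        B * (1 + 2 * l) ^ suc N + (B * (1 + 2 * l) ^ N + B * (1 + 2 * l) ^ N)
          ≡⟨ collect B l ((1 + 2 * l) ^ N) ⟩
        B * ((1 + 2 * suc l) * (1 + 2 * l) ^ N)
          ≤⟨ *-monoʳ-≤ B (*-monoʳ-≤ (1 + 2 * suc l) (^-monoˡ-≤ N (s≤s (*-monoʳ-≤ 2 (n≤1+n l))))) ⟩
        B * (1 + 2 * suc l) ^ suc N ∎
      value : ∀ x → b2n (all x pre) * altSum p (suc N) (failing ys x)
                  + ((p ∸ 1) * (b2n (all x pre) * altSum p N (failing ys x))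
                  + b2n (all x (y ++ pre)) * altSum p N (failing ys x))
                  ≈ b2n (all x pre) * altSum p (suc N) (failing (y ∷ ys) x) [mod p ]
      value x rewrite all-++ x y pre with all x y
      ... | true = ≈-trans (≈-reflexive (trans (gather A V′ (p ∸ 1) V) (cong (λ r → A * V′ + r * (A * V)) 1+[p∸1]≡p)))
          (≈-trans (≈-+ ≈-refl (∣⇒≈0 (m∣m*n (A * V)))) (≈-reflexive (+-identityʳ (A * V′))))
        where
        A V V′ : ℕ
        A = b2n (all x pre)
        V = altSum p N (failing ys x)
        V′ = altSum p (suc N) (failing ys x)
        gather : ∀ A V′ r V → A * V′ + (r * (A * V) + A * V) ≡ A * V′ + (1 + r) * (A * V)
        gather = solve-∀
      ... | false = ≈-trans (≈-reflexive (gather A V′ (p ∸ 1) V)) (≈-*ˡ A (altSum-step N (failing ys x)))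
        where
        A V V′ : ℕ
        A = b2n (all x pre)
        V = altSum p N (failing ys x)
        V′ = altSum p (suc N) (failing ys x)
        gather : ∀ A V′ r V → A * V′ + (r * (A * V) + 0) ≡ A * (V′ + r * V)
        gather = solve-∀

  -- The sum is ∑ (P / p) S_p for P = ∏ p: by the Chinese remainder theorem it
  -- determines every S_p modulo p, and the target is the residue where all S_p are 1.
  combine : ∀ (s : Input → ℕ) (e : ℕ → ℕ) {h B} {ps} → Unique ps → All Prime ps →
    All (λ p → GateSumMod p h (λ x → altSum p (p ^ e p ∸ 1) (s x)) B) ps →
    ∃ λ F → ∃ λ target → GateSum h F (length ps * B) ×
      (∀ x → s x ≡ 0 → F x ≈ target [mod product ps ]) ×
      (∀ x → F x ≈ target [mod product ps ] → product (map (λ p → p ^ e p) ps) ∣ s x)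
  combine s e [] [] [] = (λ _ → 0) , 0 , gateSum-0 , (λ _ _ → ≈-refl) , λ x _ → 1∣ s x
  combine s e {ps = p ∷ ps} (p≢ps ∷ uniq) (pr ∷ prs) ((f , R , f≈) ∷ sums)
    with F , t , R′ , accepts , detects ← combine s e uniq prs sums =
    (λ x → P * f x + p * F x) , P * 1 + p * t , gateSum-+ (gateSum-* P R) (gateSum-* p R′) ,
    (λ x sx≡0 → ≈-+
      (subst (λ q → P * f x ≈ P * 1 [mod q ]) (*-comm P p)
        (≈-scale P (≈-trans (f≈ x) (≈-reflexive (cong (altSum p (p ^ e p ∸ 1)) sx≡0)))))
      (≈-scale p (accepts x sx≡0))) ,
    (λ x F≈t → coprime-∣ (coprime-^ (e p) p⊥M) (p^e∣s x F≈t) (detects x (F≈ x F≈t)))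
    where
    P : ℕ
    P = product ps
    p⊥ps : All (Coprime p) ps
    p⊥ps = coprime-primes pr p≢ps prs
    p⊥P : Coprime p P
    p⊥P = coprime-product p⊥ps
    p⊥M : Coprime p (product (map (λ q → q ^ e q) ps))
    p⊥M = coprime-product (coprime-powers e p⊥ps)
    drop-multipleʳ : ∀ {k u v} r → k ∣ v → u ≈ r [mod k ] → u + v ≈ r [mod k ]
    drop-multipleʳ r k∣v u≈r = ≈-trans (≈-+ u≈r (∣⇒≈0 k∣v)) (≈-reflexive (+-identityʳ r))
    p^e∣s : ∀ x → P * f x + p * F x ≈ P * 1 + p * t [mod p * P ] → p ^ e p ∣ s x
    p^e∣s x F≈t with (p ^ e p) ∣? s x
    ... | yes d = d
    -- If `p ^ e p` does not divide `s x`, then `f x` vanishes modulo `p`, and the congruence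
    -- reduces modulo `p` to `P ≈ 0`, although `p` is coprime to `P`.
    ... | no ∤s = contradiction (subst Prime (p⊥P (∣-refl , ≈0⇒∣ P≈0)) pr) ¬prime[1]
      where
      Pf≈0 : P * f x ≈ 0 [mod p ]
      Pf≈0 = ≈-trans (≈-*ˡ P (≈-trans (f≈ x) (altSum≈0 (e p) (s x) pr ∤s))) (≈-reflexive (*-zeroʳ P))
      P≈0 : P ≈ 0 [mod p ]
      P≈0 = ≈-trans (≈-sym (drop-multipleʳ P (m∣m*n t) (≈-reflexive (*-identityʳ P))))
        (≈-trans (≈-sym (≈-∣ (m∣m*n P) F≈t)) (drop-multipleʳ 0 (m∣m*n (F x)) Pf≈0))
    drop-multipleˡ : ∀ {k u} v → k ∣ u → u + v ≈ v [mod k ]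
    drop-multipleˡ v k∣u = ≈-+ (∣⇒≈0 k∣u) ≈-refl
    -- Modulo `P` the multiples of `P` drop out and the factor `p` is invertible.
    F≈ : ∀ x → P * f x + p * F x ≈ P * 1 + p * t [mod p * P ] → F x ≈ t [mod P ]
    F≈ x F≈t = ≈-*-cancelˡ p⊥P (≈-trans (≈-sym (drop-multipleˡ (p * F x) (m∣m*n (f x))))
      (≈-trans (≈-∣ (n∣m*n p) F≈t) (drop-multipleˡ (p * t) (m∣m*n 1))))

  gateFor-cong : ∀ {h B} {F G : Input → Bool} → (∀ x → F x ≡ G x) → GateFor h F B → GateFor h G B
  gateFor-cong F≡G R c = record
    { ExtendsToGate (R c) ; computes = λ x → trans (ExtendsToGate.computes (R c) x) (F≡G x) }

  [1+t]^length≤product : ∀ t {ps} → All Prime ps → suc t ^ length ps ≤ product (map (λ p → p ^ exponent p t) ps)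
  [1+t]^length≤product t []         = ≤-refl
  [1+t]^length≤product t (pr ∷ prs) = *-mono-≤ (t<p^exponent (2≤prime pr) t) ([1+t]^length≤product t prs)

  -- Every power in the product is at least `suc t`, so the product exceeds `t ^ length ps`, which
  -- leaves 0 as the only multiple in range.
  small-multiple : ∀ t {s ps} → All Prime ps → 1 ≤ length ps → s ≤ t ^ length ps →
    product (map (λ p → p ^ exponent p t) ps) ∣ s → s ≡ 0
  small-multiple t {zero}            _   _   _   _ = refl
  small-multiple t {suc s} {ps} prs 1≤ω s≤a d = contradiction s≤a (<⇒≱ (begin-strict
    t ^ length ps                              <⟨ ^-monoˡ-< (length ps) {{>-nonZero 1≤ω}} (n<1+n t) ⟩
    suc t ^ length ps                          ≤⟨ [1+t]^length≤product t prs ⟩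
    product (map (λ p → p ^ exponent p t) ps)  ≤⟨ ∣⇒≤ d ⟩
    suc s                                      ∎))
    where open ≤-Reasoning

  -- The bounds use `m` in place of `p` because `combine` wants one size for all primes: `p ≤ m`
  -- gives degree `N ≤ m * t`, hence monomials of at most `m * t * b` inputs.
  failing-sum : ∀ {p h cap B b a} t ys → length ys ≤ a → All (λ y → length y ≤ b) ys → m * t * b ≤ cap →
    Conjunctions p h cap B × Prime p × p ∣ m →
    GateSumMod p h (λ x → altSum p (p ^ exponent p t ∸ 1) (failing ys x)) (B * (1 + 2 * a) ^ (m * t))
  failing-sum {p} {B = B} {b} {a} t ys len-ys small fits (conj , pr , p∣m) =
    respects (λ x → ≈-reflexive (*-identityˡ _)) (weakenMod (*-monoʳ-≤ B size)
      (altSum-blocks {{prime⇒nonZero pr}} conj N ys [] small (≤-trans (*-monoˡ-≤ b N≤mt) fits)))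
    where
    N : ℕ
    N = p ^ exponent p t ∸ 1
    N≤mt : N ≤ m * t
    N≤mt = ≤-trans (∸-monoˡ-≤ 1 (p^exponent≤1+p*t p t)) (*-monoˡ-≤ t (∣⇒≤ p∣m))
    size : (1 + 2 * length ys) ^ N ≤ (1 + 2 * a) ^ (m * t)
    size = ≤-trans (^-monoˡ-≤ N (s≤s (*-monoʳ-≤ 2 len-ys))) (^-monoʳ-≤ (1 + 2 * a) N≤mt)

  -- The gate tests the combined sum modulo the product of `ps`, which divides `m`. If no block
  -- fails, the sum hits `target`; if it hits `target`, the number of failing blocks is a multiple
  -- of the product of the prime powers, hence 0 by `small-multiple`.
  conjunctionGate : ∀ {h cap B b} t {ps} → Unique ps → All Prime ps → All (_∣ m) ps → 1 ≤ length ps →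
    All (λ p → Conjunctions p h cap B) ps → m * t * b ≤ cap →
    ∀ vs → length vs ≤ t ^ length ps * b →
    GateFor (suc h) (λ x → all x vs) (suc (length ps * (B * (1 + 2 * t ^ length ps) ^ (m * t))))
  conjunctionGate {b = b} t {ps} uniq prs ps∣m 1≤ω conjs fits vs len
    with ys , refl , len-ys , small ← chunks (t ^ length ps) b vs len
    with F , target , R , accepts , detects ← combine (failing ys) (λ p → exponent p t) uniq prs
      (All.map (failing-sum t ys len-ys small fits) (All.zip (conjs , All.zip (prs , ps∣m)))) =
    gateFor-cong correct (gate (residueIs P target) R)
    where
    P : ℕ
    P = product ps
    instance
      P≢0 : NonZero P
      P≢0 = productOfPrimes≢0 prs
    correct : ∀ x → residueIs P target (F x mod m) ≡ all x (concat ys)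
    correct x with all x (concat ys) in eq
    ... | true  = trans (residueIs-mod (product-∣ uniq prs ps∣m) target (F x))
      (dec-true (F x % P ≟ target % P) (≈⇒% (accepts x (all⇒failing≡0 ys x eq))))
    ... | false = trans (residueIs-mod (product-∣ uniq prs ps∣m) target (F x))
      (dec-false (F x % P ≟ target % P) λ e →
        contradiction (trans (sym eq) (failing≡0⇒all ys x
          (small-multiple t prs 1≤ω (≤-trans (failing≤length ys x) len-ys) (detects x (%⇒≈ e))))) λ ())

-- The induction on the depth

andF≡all : ∀ {k n} (x : Fin n → Bool) (g : Fin k → Fin n) → andF (λ i → x (g i)) ≡ all x (tabulate g)
andF≡all {zero}  x g = refl
andF≡all {suc k} x g = cong (x (g zero) ∧_) (andF≡all x (λ i → g (suc i)))

length-filter-⊆ : ∀ {a p q} {A : Set a} {P : Pred A p} {Q : Pred A q} (P? : Decidable P) (Q? : Decidable Q) →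
  P ⊆ Q → ∀ xs → length (filter P? xs) ≤ length (filter Q? xs)
length-filter-⊆ P? Q? P⊆Q [] = z≤n
length-filter-⊆ P? Q? P⊆Q (x ∷ xs) with P? x | Q? x
... | yes _  | yes _  = s≤s (length-filter-⊆ P? Q? P⊆Q xs)
... | yes px | no ¬qx = contradiction (P⊆Q px) ¬qx
... | no _   | yes _  = m≤n⇒m≤1+n (length-filter-⊆ P? Q? P⊆Q xs)
... | no _   | no _   = length-filter-⊆ P? Q? P⊆Q xs

ϖ≤ω : ∀ m → ϖ m ≤ ω m
ϖ≤ω m = length-filter-⊆ (λ p → prime? p ×-dec ((p ∣? m) ×-dec (ω m ≤? p))) (λ p → prime? p ×-dec (p ∣? m))
  (λ (pr , p∣m , _) → pr , p∣m) (upTo (suc m))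

module _ (m : ℕ) .{{_ : NonZero m}} {ps : List ℕ}
  (uniq : Unique ps) (prs : All Prime ps) (ps∣m : All (_∣ m) ps) (2≤ω : 2 ≤ length ps) where

  private
    k : ℕ
    k = length ps ∸ 1
    1+k≡ω : suc k ≡ length ps
    1+k≡ω = 1+[p∸1]≡p {{>-nonZero (≤-trans (s≤s z≤n) 2≤ω)}}
    1≤m : 1 ≤ m
    1≤m = >-nonZero⁻¹ m

  -- `L` bounds the logarithm of `t`, so the size is 2^O(t log t) with `κ` independent of `n`, `t`
  -- and `L`. It stays a free parameter because a layer calls the previous one at `m * t` and
  -- `suc m * L`, and the final circuit takes `⌈log₂ n ⌉`.
  Conjunctive : ℕ → Set
  Conjunctive h = ∃ λ κ → ∀ n t L → 1 ≤ t → 1 ≤ L → t ≤ 2 ^ L →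
    All (λ p → Layer.Conjunctions m n p (suc h) (t ^ (1 + h * k)) (2 ^ (κ * t * L))) ps

  ConjunctionGates : ℕ → Set
  ConjunctionGates h = ∃ λ κ → ∀ n t L → 1 ≤ t → 1 ≤ L → t ≤ 2 ^ L →
    ∀ vs → length vs ≤ t ^ (1 + h * k) → Layer.GateFor m n (suc h) (λ x → all x vs) (2 ^ (κ * t * L))

  Partner : ℕ → Set
  Partner p = ∃ λ q → Prime q × q ∣ m × Coprime q p

  partners : ∀ {qs} → Unique qs → All Prime qs → All (_∣ m) qs → 2 ≤ length qs → All Partner qs
  partners {a ∷ b ∷ qs} (a≢ ∷ _) (ar ∷ brs) (a∣m ∷ b∣m ∷ _) _ with coprime-primes ar a≢ brs
  -- The second prime is the partner of the first, and the first is the partner of all others.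
  ... | a⊥b ∷ a⊥qs = (b , All.head brs , b∣m , Coprimality.sym a⊥b)
    ∷ All.map {P = Coprime a} {Q = Partner} (λ a⊥q → a , ar , a∣m , a⊥q) (a⊥b ∷ a⊥qs)
  partners {_ ∷ []} _ _ _ (s≤s ())

  bottom : Conjunctive 0
  -- In `suc m`, the `m` comes from `q ≤ 2 ^ m` for each input and the 1 from the leading factor 2.
  bottom = suc m , λ n t L 1≤t 1≤L _ → All.map
    (λ {p} (pr , q , qr , q∣m , q⊥p) vs len → Layer.weakenMod m n (size (∣⇒≤ q∣m) (prime⇒nonZero qr) len 1≤t 1≤L)
      (Layer.Bottom.conjunction m n p q {{prime⇒nonZero pr}} {{prime⇒nonZero qr}} q∣m q⊥p (2≤prime qr) vs))
    (All.zip (prs , partners uniq prs ps∣m 2≤ω))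
    where
    open ≤-Reasoning
    size : ∀ {q l t L} → q ≤ m → NonZero q → l ≤ t * 1 → 1 ≤ t → 1 ≤ L → 2 * q ^ l ≤ 2 ^ (suc m * t * L)
    size {q} {l} {t} {L} q≤m q≢0 l≤t 1≤t 1≤L = begin
      2 * q ^ l              ≤⟨ *-monoʳ-≤ 2 (^-monoˡ-≤ l (≤-trans q≤m (<⇒≤ (n<2^n m)))) ⟩
      2 * (2 ^ m) ^ l        ≡⟨ cong (2 *_) (^-*-assoc 2 m l) ⟩
      2 ^ (1 + m * l)        ≤⟨ ^-monoʳ-≤ 2 (+-mono-≤ 1≤t (*-monoʳ-≤ m (≤-trans l≤t (≤-reflexive (*-identityʳ t))))) ⟩
      2 ^ (suc m * t)        ≤⟨ ^-monoʳ-≤ 2 (m≤m*n (suc m * t) L {{>-nonZero 1≤L}}) ⟩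
      2 ^ (suc m * t * L)    ∎

  -- A single gate that equals the conjunction is congruent to it modulo every prime at once.
  gates⇒conjunctive : ∀ {h} → ConjunctionGates h → Conjunctive h
  gates⇒conjunctive (κ , gates) = κ , λ n t L 1≤t 1≤L t≤2^L →
    All.universal (λ p vs len → Layer.gateSumMod-gate m n (gates n t L 1≤t 1≤L t≤2^L vs len)) ps

  -- Conjunctions of blocks are taken at scale m * t instead of t because a power of p
  -- exceeding t can be as large as p * t.
  layer : ∀ {h} → Conjunctive h → ConjunctionGates (suc h)
  layer {h} (κ , conjs) = κ′ , λ n t L 1≤t 1≤L t≤2^L vs len c →
    Layer.weakenGate m n (size t L 1≤t 1≤L t≤2^L) (Layer.conjunctionGate m n t uniq prs ps∣m (≤-trans (s≤s z≤n) 2≤ω)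
      (conjs n (m * t) (suc m * L) (*-mono-≤ 1≤m 1≤t) (≤-trans 1≤L (m≤m+n L (m * L))) (scale t L 1≤L t≤2^L))
      -- Blocks have `t ^ (h * k)` inputs, so monomials have at most `m * t * t ^ (h * k)`, within
      -- the capacity `(m * t) ^ (1 + h * k)`.
      (*-monoʳ-≤ (m * t) (^-monoˡ-≤ (h * k) (m≤n*m t m)))
      vs (≤-trans len (≤-reflexive (split t)))) c
    where
    open ≤-Reasoning
    w : ℕ
    w = length ps
    κ′ : ℕ
    -- The first `w` absorbs the factor `suc w ≤ 2 ^ w`; `κ * m * suc m` is the previous layer at
    -- the enlarged scale; `(2 + w) * m` pays for `(1 + 2 * t ^ w) ^ (m * t)`.
    κ′ = w + (κ * m * suc m + (2 + w) * m)
    split : ∀ t → t ^ (1 + suc h * k) ≡ t ^ w * t ^ (h * k)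
    split t = trans (cong (λ e → t ^ (e + h * k)) 1+k≡ω) (^-distribˡ-+-* t w (h * k))
    scale : ∀ t L → 1 ≤ L → t ≤ 2 ^ L → m * t ≤ 2 ^ (suc m * L)
    scale t L 1≤L t≤2^L = begin
      m * t              ≤⟨ *-mono-≤ (<⇒≤ (n<2^n m)) t≤2^L ⟩
      2 ^ m * 2 ^ L      ≡⟨ ^-distribˡ-+-* 2 m L ⟨
      2 ^ (m + L)        ≤⟨ ^-monoʳ-≤ 2 (+-monoˡ-≤ L (m≤m*n m L {{>-nonZero 1≤L}})) ⟩
      2 ^ (m * L + L)    ≡⟨ cong (2 ^_) (+-comm (m * L) L) ⟩
      2 ^ (suc m * L)    ∎
    size : ∀ t L → 1 ≤ t → 1 ≤ L → t ≤ 2 ^ L →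
      suc (w * (2 ^ (κ * (m * t) * (suc m * L)) * (1 + 2 * t ^ w) ^ (m * t))) ≤ 2 ^ (κ′ * t * L)
    size t L 1≤t 1≤L t≤2^L = begin
      suc (w * (2 ^ e₁ * (1 + 2 * t ^ w) ^ (m * t))) ≤⟨ s≤s (*-monoʳ-≤ w (*-monoʳ-≤ (2 ^ e₁) (^-monoˡ-≤ (m * t) base))) ⟩
      suc (w * (2 ^ e₁ * (2 ^ ((2 + w) * L)) ^ (m * t))) ≡⟨ cong (λ y → suc (w * (2 ^ e₁ * y))) (^-*-assoc 2 ((2 + w) * L) (m * t)) ⟩
      suc (w * (2 ^ e₁ * 2 ^ e₂))                    ≡⟨ cong (λ y → suc (w * y)) (^-distribˡ-+-* 2 e₁ e₂) ⟨
      suc (w * 2 ^ (e₁ + e₂))                        ≤⟨ +-monoˡ-≤ (w * 2 ^ (e₁ + e₂)) (m^n>0 2 (e₁ + e₂)) ⟩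
      suc w * 2 ^ (e₁ + e₂)                          ≤⟨ *-monoˡ-≤ (2 ^ (e₁ + e₂)) (n<2^n w) ⟩
      2 ^ w * 2 ^ (e₁ + e₂)                          ≤⟨ *-monoˡ-≤ (2 ^ (e₁ + e₂)) (^-monoʳ-≤ 2 w≤) ⟩
      2 ^ (w * t * L) * 2 ^ (e₁ + e₂)                ≡⟨ ^-distribˡ-+-* 2 (w * t * L) (e₁ + e₂) ⟨
      2 ^ (w * t * L + (e₁ + e₂))                    ≡⟨ cong (2 ^_) (collect w κ m t L) ⟩
      2 ^ (κ′ * t * L)                               ∎
      where
      e₁ e₂ : ℕ
      e₁ = κ * (m * t) * (suc m * L)
      e₂ = (2 + w) * L * (m * t)
      w≤ : w ≤ w * t * L
      w≤ = ≤-trans (m≤m*n w t {{>-nonZero 1≤t}}) (m≤m*n (w * t) L {{>-nonZero 1≤L}})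
      collect : ∀ w κ m t L → w * t * L + (κ * (m * t) * (suc m * L) + (2 + w) * L * (m * t))
                            ≡ (w + (κ * m * suc m + (2 + w) * m)) * t * L
      collect = solve-∀
      X : ℕ
      X = 2 ^ (L * w)
      quadruple : ∀ X → X + 2 * X + X ≡ 2 * (2 * X)
      quadruple = solve-∀
      base : 1 + 2 * t ^ w ≤ 2 ^ ((2 + w) * L)
      base = begin
        1 + 2 * t ^ w            ≤⟨ +-mono-≤ (m^n>0 2 (L * w)) (*-monoʳ-≤ 2 (^-monoˡ-≤ w t≤2^L)) ⟩
        X + 2 * (2 ^ L) ^ w      ≡⟨ cong (λ y → X + 2 * y) (^-*-assoc 2 L w) ⟩
        X + 2 * X                ≤⟨ m≤m+n (X + 2 * X) X ⟩
        X + 2 * X + X            ≡⟨ quadruple X ⟩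
        2 ^ (2 + L * w)          ≤⟨ ^-monoʳ-≤ 2 (+-mono-≤ (m≤m*n 2 L {{>-nonZero 1≤L}}) (≤-reflexive (*-comm L w))) ⟩
        2 ^ (2 * L + w * L)      ≡⟨ cong (2 ^_) (*-distribʳ-+ L 2 w) ⟨
        2 ^ ((2 + w) * L)        ∎

  conjunctive : ∀ h → Conjunctive h
  conjunctive zero    = bottom
  conjunctive (suc h) = gates⇒conjunctive (layer {h} (conjunctive h))

  conjunctionGates : ∀ h → ConjunctionGates (suc h)
  conjunctionGates h = layer {h} (conjunctive h)

-- Dummy gates, unused by the output, that make the depth exactly h.
chain : ∀ m n h → Circ m n h
chain m n zero    = []
chain m n (suc h) = chain m n h ▷ record { acc = λ _ → true ; inW = λ _ → 0 ; gW = λ _ → 1 }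

depth-chain : ∀ m n h → depth (chain m n h) ≡ h
depth-chain m n zero    = refl
depth-chain m n (suc h) = trans (m≥n⇒m⊔n≡m (n≤1+n (depth (chain m n h)))) (cong suc (depth-chain m n h))

-- Takes the minimum of `r` and `n`: a huge `r` would break `t ≤ 2 ^ ⌈log₂ n ⌉`, while `n` itself
-- always satisfies the last inequality.
clip : ∀ {n r} k → 1 ≤ n → 1 ≤ r → n ≤ r ^ suc k → ∃ λ t → 1 ≤ t × t ≤ n × t ≤ r × n ≤ t ^ suc k
clip {n} {r} k 1≤n 1≤r n≤r^ with ≤-total r n
... | inj₁ r≤n = r , 1≤r , r≤n , ≤-refl , n≤r^
... | inj₂ n≤r = n , 1≤n , ≤-refl , n≤r , m≤m*n n (n ^ k) {{m^n≢0 n k {{>-nonZero 1≤n}}}}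

theorem1p2 : (h m : ℕ) .{{_ : NonZero m}} → 3 ≤ h → 2 ≤ ω m →
    Σ ℕ λ C → Σ ℕ λ N → (n r : ℕ) → N ≤ n →
    n ≤ r ^ ((ω m ∸ 1) * (h ∸ 2) + ϖ m) →
    Σ ℕ λ s → Σ (Circ m n s) λ c → Σ (Fin s) λ o →
    depth c ≡ h × Computes c o (AND n) × s ≤ 2 ^ (C * r * ⌈log₂ n ⌉)
theorem1p2 h@(suc (suc h′)) m (s≤s (s≤s _)) 2≤ω = h + κ , 2 , circuits
  where
  isPrimeDivisor? : ∀ p → _
  isPrimeDivisor? p = prime? p ×-dec (p ∣? m)
  primeDivisors : All (λ p → Prime p × p ∣ m) (filter isPrimeDivisor? (upTo (suc m)))
  primeDivisors = all-filter isPrimeDivisor? (upTo (suc m))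
  uniq : Unique (filter isPrimeDivisor? (upTo (suc m)))
  uniq = filter⁺ isPrimeDivisor? (upTo⁺ (suc m))
  k : ℕ
  k = ω m ∸ 1
  gates : ConjunctionGates m uniq (All.map proj₁ primeDivisors) (All.map proj₂ primeDivisors) 2≤ω (suc h′)
  gates = conjunctionGates m uniq (All.map proj₁ primeDivisors) (All.map proj₂ primeDivisors) 2≤ω h′
  κ : ℕ
  κ = proj₁ gates
  -- With `h′` equal to `h ∸ 2`, replacing `ϖ` by `ω = 1 + k` gives exactly the exponent reached at
  -- depth `h`.
  exponent≤ : k * h′ + ϖ m ≤ 1 + suc h′ * k
  exponent≤ = begin
    k * h′ + ϖ m        ≤⟨ +-monoʳ-≤ (k * h′) (ϖ≤ω m) ⟩
    k * h′ + ω m        ≡⟨ cong (k * h′ +_) (1+[p∸1]≡p {{>-nonZero (≤-trans (s≤s z≤n) 2≤ω)}}) ⟨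
    k * h′ + suc k      ≡⟨ rearrange k h′ ⟩
    1 + suc h′ * k      ∎
    where
    open ≤-Reasoning
    rearrange : ∀ k h → k * h + suc k ≡ 1 + suc h * k
    rearrange = solve-∀
  circuits : (n r : ℕ) → 2 ≤ n → n ≤ r ^ (k * h′ + ϖ m) →
    Σ ℕ λ s → Σ (Circ m n s) λ c → Σ (Fin s) λ o →
    depth c ≡ h × Computes c o (AND n) × s ≤ 2 ^ ((h + κ) * r * ⌈log₂ n ⌉)
  -- Even if the exponent is 0, where the power is 1, a power of 0 stays below `2 ≤ n`.
  circuits n zero    2≤n n≤ = contradiction (≤-trans 2≤n (≤-trans n≤
    (≤-trans (^-monoˡ-≤ (k * h′ + ϖ m) z≤n) (≤-reflexive (^-zeroˡ (k * h′ + ϖ m)))))) λ { (s≤s ()) }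
  circuits n r@(suc _) 2≤n n≤
    with t , 1≤t , t≤n , t≤r , n≤t^ ← clip (suc h′ * k) (≤-trans (s≤s z≤n) 2≤n) (s≤s z≤n) (≤-trans n≤ (^-monoʳ-≤ r exponent≤)) =
    _ , circuit , zero ,
    -- The upper bound holds since the chain and the output gate both fit in depth `h`; the lower
    -- bound because the circuit extends the chain.
    ≤-antisym (depth≤ h ≤-refl (≤-reflexive (depth-chain m n h)))
      (≤-trans (≤-reflexive (sym (depth-chain m n h))) (Layer.⊑-depth m n extends)) ,
    (λ x → trans (computes x) (sym (andF≡all x id))) ,
    ≤-trans size≤ bound
    where
    L : ℕ
    L = ⌈log₂ n ⌉
    1≤L : 1 ≤ L
    -- The threshold 2 for `n` makes the logarithm positive.
    1≤L = ⌈log₂⌉-mono-≤ 2≤n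
    extension : Layer.ExtendsToGate m n (chain m n h) h (λ x → all x (allFin n)) (2 ^ (κ * t * L))
    extension = proj₂ gates n t L 1≤t 1≤L (≤-trans t≤n (n≤2^⌈log₂n⌉ n)) (allFin n)
      (subst (_≤ t ^ (1 + suc h′ * k)) (sym (length-tabulate id)) n≤t^) (chain m n h)
    open Layer.ExtendsToGate m n extension
    open ≤-Reasoning
    Y : ℕ
    Y = 2 ^ (κ * t * L)
    distribute : ∀ h κ r L → h * r * L + κ * r * L ≡ (h + κ) * r * L
    distribute = solve-∀
    -- The `h` gates of the chain are paid by the summand `h` of the constant, through
    -- `suc h ≤ 2 ^ h`.
    bound : h + Y ≤ 2 ^ ((h + κ) * r * L)
    bound = begin
      h + Y                            ≤⟨ +-monoˡ-≤ Y (m≤m*n h Y {{m^n≢0 2 (κ * t * L)}}) ⟩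
      h * Y + Y                        ≡⟨ +-comm (h * Y) Y ⟩
      suc h * Y                        ≤⟨ *-monoˡ-≤ Y (n<2^n h) ⟩
      2 ^ h * Y                        ≡⟨ ^-distribˡ-+-* 2 h (κ * t * L) ⟨
      2 ^ (h + κ * t * L)              ≤⟨ ^-monoʳ-≤ 2 (+-mono-≤ (≤-trans (m≤m*n h r) (m≤m*n (h * r) L {{>-nonZero 1≤L}})) (*-monoˡ-≤ L (*-monoʳ-≤ κ t≤r))) ⟩
      2 ^ (h * r * L + κ * r * L)      ≡⟨ cong (2 ^_) (distribute h κ r L) ⟩
      2 ^ ((h + κ) * r * L)            ∎
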